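{- For every fixed positive integer $n$, the sequence $\mathrm{BoNa}(n,1),\mathrm{BoNa}(n,2),\ldots,\mathrm{BoNa}(n,n)$ is unimodal.
   Context: A binary plane tree is a rooted plane tree on unlabeled vertices in which every non-leaf vertex has one or two children, and every child is a left child or a right child, even if it is the only child of its parent. A 0-1-tree is a binary plane tree in which every vertex that has two children is labeled 0 or 1 (no other vertex is labeled). A right edge is an edge connecting a vertex to its right child. For $n\ge 1$, the Boolean-Narayana number $\mathrm{BoNa}(n,k)$ is the number of 0-1-trees on $n$ vertices that have exactly $k-1$ right edges. A sequence $a_1,\ldots,a_n$ is unimodal if there exists an index $k$ such that $a_1\leq a_2\leq \cdots\leq a_k\geq a_{k+1}\geq\cdots\geq a_n$. -}

module Defs where

open import Data.Empty using (⊥)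
open import Data.Fin.Base using (Fin)
open import Data.List.Base using (List; []; _∷_; _++_; map; filter; length; allFin; cartesianProduct; cartesianProductWith)
open import Data.List.Membership.Propositional using (_∈_)
open import Data.List.Membership.Propositional.Properties
  using (∈-map⁺; ∈-map⁻; ∈-++⁺ˡ; ∈-++⁺ʳ; ∈-++⁻; ∈-allFin; ∈-cartesianProduct⁺; ∈-cartesianProductWith⁺; ∈-cartesianProductWith⁻; ∈-filter⁺; ∈-filter⁻)
open import Data.List.Relation.Unary.All using ([])
open import Data.List.Relation.Unary.AllPairs using ([]; _∷_)
open import Data.List.Relation.Unary.Any using (here; there)
open import Data.List.Relation.Unary.Unique.Propositional using (Unique)
import Data.List.Relation.Unary.Unique.Propositional.Properties as Uniqueₚ
open import Data.Nat.Base using (ℕ; zero; suc; _+_; _≤_; _<_; z≤n; s≤s)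
open import Data.Nat.Properties using (_≟_; ≤-refl; ≤-trans; m≤m+n; m≤n+m)
open import Data.Product.Base using (_×_; _,_; proj₂; ∃-syntax)
open import Data.Sum.Base using (inj₁; inj₂)
open import Function.Bundles using (_⇔_; mk⇔)
open import Relation.Binary.PropositionalEquality using (_≡_; refl; subst)
open import Relation.Nullary.Decidable using (Dec; _×-dec_)

-- Nonempty by construction: leaf is the one-vertex tree.  The argument of
-- type Fin 2 is the label 0 or 1 of a vertex with two children.
data ZeroOneTree : Set where
  leaf      : ZeroOneTree
  onlyLeft  : ZeroOneTree → ZeroOneTree
  onlyRight : ZeroOneTree → ZeroOneTree
  both      : Fin 2 → ZeroOneTree → ZeroOneTree → ZeroOneTree

vertices : ZeroOneTree → ℕ
vertices leaf          = 1
vertices (onlyLeft l)  = suc (vertices l)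
vertices (onlyRight r) = suc (vertices r)
vertices (both _ l r)  = suc (vertices l + vertices r)

rightEdges : ZeroOneTree → ℕ
rightEdges leaf          = 0
rightEdges (onlyLeft l)  = rightEdges l
rightEdges (onlyRight r) = suc (rightEdges r)
rightEdges (both _ l r)  = suc (rightEdges l + rightEdges r)

-- "k - 1 right edges" is written without truncated subtraction, so no tree
-- is counted for k = 0.
Counted : ℕ → ℕ → ZeroOneTree → Set
Counted n k t = vertices t ≡ n × suc (rightEdges t) ≡ k

counted? : ∀ n k t → Dec (Counted n k t)
counted? n k t = (vertices t ≟ n) ×-dec (suc (rightEdges t) ≟ k)

-- All trees with at most h vertices on every path down from the root.
boundedTrees : ℕ → List ZeroOneTree
boundedTrees zero    = []
boundedTrees (suc h) =
  leaf ∷ map onlyLeft ts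
      ++ map onlyRight ts
      ++ cartesianProductWith (λ b (l , r) → both b l r) (allFin 2) (cartesianProduct ts ts)
  where ts = boundedTrees h

-- A tree with n vertices has no path with more than n vertices, so this
-- filtering loses nothing; see ∈-countedTrees.
countedTrees : ℕ → ℕ → List ZeroOneTree
countedTrees n k = filter (counted? n k) (boundedTrees n)

BoNa : ℕ → ℕ → ℕ
BoNa n k = length (countedTrees n k)

-- Unimodality of the finite sequence a 1 , … , a n; other values of a are
-- irrelevant.
Unimodal : ℕ → (ℕ → ℕ) → Set
Unimodal n a =
  ∃[ k ] (1 ≤ k × k ≤ n
    × (∀ i → 1 ≤ i → i < k → a i ≤ a (suc i))
    × (∀ i → k ≤ i → i < n → a (suc i) ≤ a i))

-- The remaining lemmas show that BoNa n k is the cardinality of the set of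
-- trees satisfying Counted n k: countedTrees n k lists each exactly once.

∈-boundedTrees : ∀ h t → vertices t ≤ h → t ∈ boundedTrees h
∈-boundedTrees (suc h) leaf          _       = here refl
∈-boundedTrees (suc h) (onlyLeft l)  (s≤s p) =
  there (∈-++⁺ˡ (∈-map⁺ onlyLeft (∈-boundedTrees h l p)))
∈-boundedTrees (suc h) (onlyRight r) (s≤s p) =
  there (∈-++⁺ʳ (map onlyLeft (boundedTrees h)) (∈-++⁺ˡ (∈-map⁺ onlyRight (∈-boundedTrees h r p))))
∈-boundedTrees (suc h) (both b l r)  (s≤s p) =
  there (∈-++⁺ʳ (map onlyLeft (boundedTrees h)) (∈-++⁺ʳ (map onlyRight (boundedTrees h))
    (∈-cartesianProductWith⁺ (λ b (l , r) → both b l r) (∈-allFin b)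
      (∈-cartesianProduct⁺
        (∈-boundedTrees h l (≤-trans (m≤m+n (vertices l) (vertices r)) p))
        (∈-boundedTrees h r (≤-trans (m≤n+m (vertices r) (vertices l)) p))))))

boundedTrees-unique : ∀ h → Unique (boundedTrees h)
boundedTrees-unique zero    = []
boundedTrees-unique (suc h) =
  Uniqueₚ.++⁺ ([] ∷ [])
    (Uniqueₚ.++⁺ (Uniqueₚ.map⁺ (λ { refl → refl }) ih)
      (Uniqueₚ.++⁺ (Uniqueₚ.map⁺ (λ { refl → refl }) ih)
        (Uniqueₚ.cartesianProductWith⁺ node (λ { refl → refl , refl })
          (Uniqueₚ.allFin⁺ 2) (Uniqueₚ.cartesianProduct⁺ ih ih))
        λ (p , q) → right∉both p q)
      λ (p , q) → left∉rest p q)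
    λ { (here refl , q) → leaf∉rest q }
  where
  ts = boundedTrees h
  ih = boundedTrees-unique h
  node : Fin 2 → ZeroOneTree × ZeroOneTree → ZeroOneTree
  node b (l , r) = both b l r
  bs = cartesianProductWith node (allFin 2) (cartesianProduct ts ts)

  right∉both : ∀ {t} → t ∈ map onlyRight ts → t ∈ bs → ⊥
  right∉both p q with ∈-map⁻ onlyRight p | ∈-cartesianProductWith⁻ node (allFin 2) (cartesianProduct ts ts) q
  ... | _ , _ , refl | _ , _ , _ , _ , ()

  left∉rest : ∀ {t} → t ∈ map onlyLeft ts → t ∈ map onlyRight ts ++ bs → ⊥
  left∉rest p q with ∈-map⁻ onlyLeft p | ∈-++⁻ (map onlyRight ts) q
  ... | _ , _ , refl | inj₁ q′ with () ← proj₂ (proj₂ (∈-map⁻ onlyRight q′))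
  ... | _ , _ , refl | inj₂ q′
    with _ , _ , _ , _ , () ← ∈-cartesianProductWith⁻ node (allFin 2) (cartesianProduct ts ts) q′

  leaf∉rest : leaf ∈ map onlyLeft ts ++ map onlyRight ts ++ bs → ⊥
  leaf∉rest q with ∈-++⁻ (map onlyLeft ts) q
  ... | inj₁ q′ with () ← proj₂ (proj₂ (∈-map⁻ onlyLeft q′))
  ... | inj₂ q′ with ∈-++⁻ (map onlyRight ts) q′
  ...   | inj₁ q″ with () ← proj₂ (proj₂ (∈-map⁻ onlyRight q″))
  ...   | inj₂ q″
    with _ , _ , _ , _ , () ← ∈-cartesianProductWith⁻ node (allFin 2) (cartesianProduct ts ts) q″

∈-countedTrees : ∀ n k t → t ∈ countedTrees n k ⇔ Counted n k t
∈-countedTrees n k t = mk⇔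
  (λ p → proj₂ (∈-filter⁻ (counted? n k) {xs = boundedTrees n} p))
  (λ { (refl , e) → ∈-filter⁺ (counted? n k) (∈-boundedTrees n t ≤-refl) (refl , e) })

countedTrees-unique : ∀ n k → Unique (countedTrees n k)
countedTrees-unique n k = Uniqueₚ.filter⁺ (counted? n k) (boundedTrees-unique n)

{-# OPTIONS --safe #-}

-- Flipping the only child of a vertex from left to right adds one right edge
-- and keeps the number of vertices.  Trees that differ only by such flips
-- form a class; if its members have u vertices with one child and b with
-- two, then C(u, j) of them have b + j right edges, and they all have
-- 1 + u + 2b vertices.  So, for fixed n, BoNa(n, k) is a sum of binomial
-- coefficients C(u, k − 1 − b) with u + 2b = n − 1, and as functions of k
-- all of these increase up to, and decrease from, the same point (n + 1) / 2.
module Submission where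

open import Defs
open import Data.Bool.Base using (true; false; if_then_else_; _∧_; T)
open import Data.Fin.Base using (Fin)
open import Data.List.Base using (List; []; _∷_; _++_; map; filter; length; allFin; cartesianProduct; cartesianProductWith)
open import Data.List.Properties using (map-cong; map-∘; map-++)
open import Data.Nat.Base using (ℕ; zero; suc; _+_; _*_; _≤_; _<_; _≡ᵇ_; z≤n; s≤s; s≤s⁻¹; ⌊_/2⌋; ⌈_/2⌉)
open import Data.Nat.Combinatorics using (_C_; nCk+nC[k+1]≡[n+1]C[k+1])
open import Data.Nat.ListAction using (sum)
open import Data.Nat.ListAction.Properties using (sum-++)
open import Data.Nat.Properties
open import Data.Nat.Tactic.RingSolver using (solve-∀)
open import Algebra.Properties.CommutativeSemigroup +-commutativeSemigroup using (interchange)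
open import Data.Product.Base using (_×_; _,_)
open import Function.Base using (_∘_)
open import Relation.Binary.PropositionalEquality
open import Relation.Nullary.Decidable using (Dec; does)

-- Finite sums over lists.

private variable
  A B D : Set

∑ : (A → ℕ) → List A → ℕ
∑ f xs = sum (map f xs)

∑-cong : {f g : A → ℕ} → (∀ x → f x ≡ g x) → ∀ xs → ∑ f xs ≡ ∑ g xs
∑-cong f≗g xs = cong sum (map-cong f≗g xs)

∑-mono : {f g : A → ℕ} → (∀ x → f x ≤ g x) → ∀ xs → ∑ f xs ≤ ∑ g xs
∑-mono f≤g []       = z≤n
∑-mono f≤g (x ∷ xs) = +-mono-≤ (f≤g x) (∑-mono f≤g xs)

∑-++ : (f : A → ℕ) → ∀ xs ys → ∑ f (xs ++ ys) ≡ ∑ f xs + ∑ f ys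
∑-++ f xs ys = trans (cong sum (map-++ f xs ys)) (sum-++ (map f xs) (map f ys))

∑-map : (f : B → ℕ) (g : A → B) → ∀ xs → ∑ f (map g xs) ≡ ∑ (f ∘ g) xs
∑-map f g xs = cong sum (sym (map-∘ xs))

∑-+ : (f g : A → ℕ) → ∀ xs → ∑ (λ x → f x + g x) xs ≡ ∑ f xs + ∑ g xs
∑-+ f g []       = refl
∑-+ f g (x ∷ xs) =
  trans (cong (f x + g x +_) (∑-+ f g xs)) (interchange (f x) (g x) (∑ f xs) (∑ g xs))

∑-0 : (xs : List A) → ∑ (λ _ → 0) xs ≡ 0
∑-0 []       = refl
∑-0 (_ ∷ xs) = ∑-0 xs

∑-swap : (f : A → B → ℕ) → ∀ xs ys →
  ∑ (λ x → ∑ (f x) ys) xs ≡ ∑ (λ y → ∑ (λ x → f x y) xs) ys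
∑-swap f []       ys = sym (∑-0 ys)
∑-swap f (x ∷ xs) ys =
  trans (cong (∑ (f x) ys +_) (∑-swap f xs ys)) (sym (∑-+ (f x) (λ y → ∑ (λ x → f x y) xs) ys))

∑-cartesianProductWith : (f : D → ℕ) (g : A → B → D) → ∀ xs ys →
  ∑ f (cartesianProductWith g xs ys) ≡ ∑ (λ x → ∑ (λ y → f (g x y)) ys) xs
∑-cartesianProductWith f g []       ys = refl
∑-cartesianProductWith f g (x ∷ xs) ys =
  trans (∑-++ f (map (g x) ys) (cartesianProductWith g xs ys))
        (cong₂ _+_ (∑-map f (g x) ys) (∑-cartesianProductWith f g xs ys))

length-filter : {P : A → Set} (P? : ∀ x → Dec (P x)) → ∀ xs →
  length (filter P? xs) ≡ ∑ (λ x → if does (P? x) then 1 else 0) xs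
length-filter P? []       = refl
length-filter P? (x ∷ xs) with does (P? x)
... | true  = cong suc (length-filter P? xs)
... | false = length-filter P? xs

-- Sums over subsets.

-- The sum of h (b + ∣ S ∣) over all subsets S of a u-element set.
subsetSum : ℕ → (ℕ → ℕ) → ℕ → ℕ
subsetSum zero    h b = h b
subsetSum (suc u) h b = subsetSum u h b + subsetSum u h (suc b)

subsetSum-translate : ∀ u h b c → subsetSum u (λ y → h (b + y)) c ≡ subsetSum u h (b + c)
subsetSum-translate zero    h b c = refl
subsetSum-translate (suc u) h b c = cong₂ _+_ (subsetSum-translate u h b c)
  (trans (subsetSum-translate u h b (suc c)) (cong (subsetSum u h) (+-suc b c)))

-- A subset of a disjoint union is a pair of subsets, and their cardinalities add.
subsetSum-union : ∀ u v h b c →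
  subsetSum u (λ x → subsetSum v (λ y → h (x + y)) c) b ≡ subsetSum (u + v) h (b + c)
subsetSum-union zero    v h b c = subsetSum-translate v h b c
subsetSum-union (suc u) v h b c =
  cong₂ _+_ (subsetSum-union u v h b c) (subsetSum-union u v h (suc b) c)

-- Classes of trees under flipping.

-- A class of trees is encoded by its numbers (u , b) of vertices with one
-- and with two children.
Class : Set
Class = ℕ × ℕ

size : Class → ℕ
size (u , b) = suc (u + (b + b))

-- The total of `h (rightEdges t)` over the members of a class: each vertex with two children forces
-- one right edge, and a subset of the vertices with one child selects those whose child is a right
-- child.
classSum : Class → (ℕ → ℕ) → ℕ
classSum (u , b) h = subsetSum u h b

addUnary : Class → Class
addUnary (u , b) = suc u , b

join : Class → Class → Class
join (u , b) (v , c) = u + v , suc (b + c)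

-- The summands correspond to the new root having a left or a right only child, that is, to its
-- lying outside or inside the chosen subset.
classSum-addUnary : ∀ c (h : ℕ → ℕ) →
  classSum c h + classSum c (h ∘ suc) ≡ classSum (addUnary c) h
classSum-addUnary (u , b) h = cong (subsetSum u h b +_) (subsetSum-translate u h 1 b)

size-join : ∀ c d → size (join c d) ≡ suc (size c + size d)
size-join (u , b) (v , c) = lemma u b v c
  where
  lemma : ∀ u b v c → suc (u + v + (suc (b + c) + suc (b + c))) ≡ suc (suc (u + (b + b)) + suc (v + (c + c)))
  lemma = solve-∀

classSum-join : ∀ c d (h : ℕ → ℕ) →
  classSum c (λ x → classSum d (λ y → h (suc (x + y)))) ≡ classSum (join c d) h
classSum-join (u , b) (v , c) h =
  trans (subsetSum-union u v (h ∘ suc) b c) (subsetSum-translate (u + v) h 1 (b + c))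

-- Follows the recursion of `boundedTrees` with `onlyLeft` and `onlyRight` merged, so a pair is
-- repeated once for each class having these numbers. The label only doubles the entries. The right
-- subtree comes first in `(d , c)` to match the order of summation reached in `pairs`.
classes : ℕ → List Class
classes zero    = []
classes (suc h) =
  (0 , 0) ∷ map addUnary cs
    ++ cartesianProductWith (λ (_ : Fin 2) (d , c) → join c d) (allFin 2) (cartesianProduct cs cs)
  where cs = classes h

-- Induction on `h` with `g` arbitrary, since the contribution of the root, and of the other subtree
-- if there is one, is absorbed into `g`.
∑-boundedTrees : ∀ h (g : ℕ → ℕ → ℕ) →
  ∑ (λ t → g (vertices t) (rightEdges t)) (boundedTrees h) ≡ ∑ (λ c → classSum c (g (size c))) (classes h)
∑-boundedTrees zero    g = refl
∑-boundedTrees (suc h) g = cong (g 1 0 +_) (begin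
  ∑ weight (map onlyLeft ts ++ map onlyRight ts ++ bs)
    ≡⟨ ∑-++ weight (map onlyLeft ts) (map onlyRight ts ++ bs) ⟩
  ∑ weight (map onlyLeft ts) + ∑ weight (map onlyRight ts ++ bs)
    ≡⟨ cong (∑ weight (map onlyLeft ts) +_) (∑-++ weight (map onlyRight ts) bs) ⟩
  ∑ weight (map onlyLeft ts) + (∑ weight (map onlyRight ts) + ∑ weight bs)
    ≡⟨ +-assoc (∑ weight (map onlyLeft ts)) _ _ ⟨
  ∑ weight (map onlyLeft ts) + ∑ weight (map onlyRight ts) + ∑ weight bs
    ≡⟨ cong₂ _+_ unary binary ⟩
  ∑ value (map addUnary cs) + ∑ value js
    ≡⟨ ∑-++ value (map addUnary cs) js ⟨
  ∑ value (map addUnary cs ++ js) ∎)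
  where
  open ≡-Reasoning
  ts = boundedTrees h
  cs = classes h
  node : Fin 2 → ZeroOneTree × ZeroOneTree → ZeroOneTree
  node i (l , r) = both i l r
  bs = cartesianProductWith node (allFin 2) (cartesianProduct ts ts)
  joinPair : Fin 2 → Class × Class → Class
  joinPair _ (d , c) = join c d
  js = cartesianProductWith joinPair (allFin 2) (cartesianProduct cs cs)
  weight : ZeroOneTree → ℕ
  weight t = g (vertices t) (rightEdges t)
  value : Class → ℕ
  value c = classSum c (g (size c))

  unary : ∑ weight (map onlyLeft ts) + ∑ weight (map onlyRight ts) ≡ ∑ value (map addUnary cs)
  unary = begin
    ∑ weight (map onlyLeft ts) + ∑ weight (map onlyRight ts)
      ≡⟨ cong₂ _+_ (∑-map weight onlyLeft ts) (∑-map weight onlyRight ts) ⟩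
    ∑ (weight ∘ onlyLeft) ts + ∑ (weight ∘ onlyRight) ts
      ≡⟨ cong₂ _+_ (∑-boundedTrees h (λ n → g (suc n))) (∑-boundedTrees h (λ n → g (suc n) ∘ suc)) ⟩
    ∑ (λ c → classSum c (g (suc (size c)))) cs + ∑ (λ c → classSum c (g (suc (size c)) ∘ suc)) cs
      ≡⟨ ∑-+ (λ c → classSum c (g (suc (size c)))) _ cs ⟨
    ∑ (λ c → classSum c (g (suc (size c))) + classSum c (g (suc (size c)) ∘ suc)) cs
      ≡⟨ ∑-cong (λ c → classSum-addUnary c (g (suc (size c)))) cs ⟩
    ∑ (value ∘ addUnary) cs
      ≡⟨ ∑-map value addUnary cs ⟨
    ∑ value (map addUnary cs) ∎

  pairs : ∀ i → ∑ (weight ∘ node i) (cartesianProduct ts ts) ≡ ∑ (value ∘ joinPair i) (cartesianProduct cs cs)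
  pairs i = begin
    ∑ (weight ∘ node i) (cartesianProduct ts ts)
      ≡⟨ ∑-cartesianProductWith (weight ∘ node i) _,_ ts ts ⟩
    ∑ (λ l → ∑ (λ r → weight (both i l r)) ts) ts
      -- The right subtrees are replaced by classes while `l` is fixed; after the swap of sums the
      -- same is done to the left subtrees with `d` fixed.
      ≡⟨ ∑-cong (λ l → ∑-boundedTrees h (λ n y → g (suc (vertices l + n)) (suc (rightEdges l + y)))) ts ⟩
    ∑ (λ l → ∑ (λ d → classSum d (λ y → g (suc (vertices l + size d)) (suc (rightEdges l + y)))) cs) ts
      ≡⟨ ∑-swap _ ts cs ⟩
    ∑ (λ d → ∑ (λ l → classSum d (λ y → g (suc (vertices l + size d)) (suc (rightEdges l + y)))) ts) cs
      ≡⟨ ∑-cong (λ d → ∑-boundedTrees h (λ n x → classSum d (λ y → g (suc (n + size d)) (suc (x + y))))) cs ⟩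
    ∑ (λ d → ∑ (λ c → classSum c (λ x → classSum d (λ y → g (suc (size c + size d)) (suc (x + y))))) cs) cs
      ≡⟨ ∑-cong (λ d → ∑-cong (λ c → trans (classSum-join c d (g (suc (size c + size d))))
           (cong (λ n → classSum (join c d) (g n)) (sym (size-join c d)))) cs) cs ⟩
    ∑ (λ d → ∑ (λ c → value (join c d)) cs) cs
      ≡⟨ ∑-cartesianProductWith (value ∘ joinPair i) _,_ cs cs ⟨
    ∑ (value ∘ joinPair i) (cartesianProduct cs cs) ∎

  binary : ∑ weight bs ≡ ∑ value js
  binary = begin
    ∑ weight bs
      ≡⟨ ∑-cartesianProductWith weight node (allFin 2) (cartesianProduct ts ts) ⟩
    ∑ (λ i → ∑ (weight ∘ node i) (cartesianProduct ts ts)) (allFin 2)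
      ≡⟨ ∑-cong pairs (allFin 2) ⟩
    ∑ (λ i → ∑ (value ∘ joinPair i) (cartesianProduct cs cs)) (allFin 2)
      ≡⟨ ∑-cartesianProductWith value joinPair (allFin 2) (cartesianProduct cs cs) ⟨
    ∑ value js ∎

-- Monotonicity of binomial coefficients.

-- The absorption identity (k + 1) C(n, k + 1) = (n − k) C(n, k) without
-- subtraction.
C-absorption : ∀ n k → suc k * (n C suc k) + k * (n C k) ≡ n * (n C k)
C-absorption zero    zero    = refl
C-absorption zero    (suc k) = trans (cong₂ _+_ (*-zeroʳ (suc (suc k))) (*-zeroʳ (suc k))) refl
C-absorption (suc n) zero    = begin
  1 * (suc n C 1) + 0    ≡⟨ cong (λ x → 1 * x + 0) (nCk+nC[k+1]≡[n+1]C[k+1] n 0) ⟨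
  1 * (1 + n C 1) + 0    ≡⟨ cong suc (C-absorption n 0) ⟩
  suc n * 1              ∎
  where open ≡-Reasoning
C-absorption (suc n) (suc k) = begin
  suc (suc k) * (suc n C suc (suc k)) + suc k * (suc n C suc k)
    ≡⟨ cong₂ (λ x y → suc (suc k) * x + suc k * y) (nCk+nC[k+1]≡[n+1]C[k+1] n (suc k)) (nCk+nC[k+1]≡[n+1]C[k+1] n k) ⟨
  suc (suc k) * (b + c) + suc k * (a + b)
    -- After Pascal's rule, the terms are arranged into the induction hypotheses at `suc k` and `k`,
    -- leaving `a + b`.
    ≡⟨ regroup k a b c ⟩
  (suc (suc k) * c + suc k * b) + (suc k * b + k * a) + (a + b)
    ≡⟨ cong₂ (λ x y → x + y + (a + b)) (C-absorption n (suc k)) (C-absorption n k) ⟩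
  n * b + n * a + (a + b)
    ≡⟨ collect n a b ⟩
  suc n * (a + b)
    ≡⟨ cong (suc n *_) (nCk+nC[k+1]≡[n+1]C[k+1] n k) ⟩
  suc n * (suc n C suc k) ∎
  where
  open ≡-Reasoning
  a = n C k
  b = n C suc k
  c = n C suc (suc k)
  regroup : ∀ k a b c → suc (suc k) * (b + c) + suc k * (a + b)
    ≡ (suc (suc k) * c + suc k * b) + (suc k * b + k * a) + (a + b)
  regroup = solve-∀
  collect : ∀ n a b → n * b + n * a + (a + b) ≡ suc n * (a + b)
  collect = solve-∀

-- Multiplying by `suc k` and adding `k * (n C k)` makes absorption applicable, which reduces the
-- claim to comparing `suc (k + k)` with `n`.
C-ascending : ∀ n k → suc (k + k) ≤ n → n C k ≤ n C suc k
C-ascending n k 2k<n = *-cancelˡ-≤ (suc k) (+-cancelʳ-≤ (k * (n C k)) _ _ (begin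
  suc k * (n C k) + k * (n C k)     ≡⟨ *-distribʳ-+ (n C k) (suc k) k ⟨
  suc (k + k) * (n C k)             ≤⟨ *-monoˡ-≤ (n C k) 2k<n ⟩
  n * (n C k)                       ≡⟨ C-absorption n k ⟨
  suc k * (n C suc k) + k * (n C k) ∎))
  where open ≤-Reasoning

C-descending : ∀ n k → n ≤ suc (k + k) → n C suc k ≤ n C k
C-descending n k n≤2k+1 = *-cancelˡ-≤ (suc k) (+-cancelʳ-≤ (k * (n C k)) _ _ (begin
  suc k * (n C suc k) + k * (n C k) ≡⟨ C-absorption n k ⟩
  n * (n C k)                       ≤⟨ *-monoˡ-≤ (n C k) n≤2k+1 ⟩
  suc (k + k) * (n C k)             ≡⟨ *-distribʳ-+ (n C k) (suc k) k ⟩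
  suc k * (n C k) + k * (n C k)     ∎))
  where open ≤-Reasoning

-- Subset sums as binomial coefficients.

indicator : ℕ → ℕ → ℕ
indicator k r = if suc r ≡ᵇ k then 1 else 0

subsetSum-indicator-0 : ∀ u b → subsetSum u (indicator 0) b ≡ 0
subsetSum-indicator-0 zero    b = refl
subsetSum-indicator-0 (suc u) b = cong₂ _+_ (subsetSum-indicator-0 u b) (subsetSum-indicator-0 u (suc b))

subsetSum-indicator-suc : ∀ u k b → subsetSum u (indicator (suc k)) (suc b) ≡ subsetSum u (indicator k) b
subsetSum-indicator-suc u k b = sym (subsetSum-translate u (indicator (suc k)) 1 b)

-- Pascal's rule, splitting subsets by whether they contain a given element.
subsetSum-indicator-C : ∀ u k → subsetSum u (indicator (suc k)) 0 ≡ u C k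
subsetSum-indicator-C zero    zero    = refl
subsetSum-indicator-C zero    (suc k) = refl
subsetSum-indicator-C (suc u) zero    = cong₂ _+_ (subsetSum-indicator-C u 0)
  (trans (subsetSum-indicator-suc u 0 0) (subsetSum-indicator-0 u 0))
subsetSum-indicator-C (suc u) (suc k) = begin
  subsetSum u (indicator (suc (suc k))) 0 + subsetSum u (indicator (suc (suc k))) 1
    ≡⟨ cong₂ _+_ (subsetSum-indicator-C u (suc k)) (trans (subsetSum-indicator-suc u (suc k) 0) (subsetSum-indicator-C u k)) ⟩
  u C suc k + u C k ≡⟨ +-comm (u C suc k) (u C k) ⟩
  u C k + u C suc k ≡⟨ nCk+nC[k+1]≡[n+1]C[k+1] u k ⟩
  suc u C suc k     ∎
  where open ≡-Reasoning

double-suc : ∀ k → suc k + suc k ≡ suc (suc (k + k))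
double-suc k = cong suc (+-suc k k)

size-suc : ∀ u b → size (u , suc b) ≡ suc (suc (size (u , b)))
size-suc u b = cong suc (trans (cong (u +_) (double-suc b)) (trans (+-suc u _) (cong suc (+-suc u _))))

-- Lowering `b` and `k` by one lowers both `k + k` and the size by two, so the hypothesis persists
-- down to `b = 0`, where the sums are binomial coefficients. Hence the turning point depends only
-- on the size.
subsetSum-ascending : ∀ u b k → k + k ≤ size (u , b) →
  subsetSum u (indicator k) b ≤ subsetSum u (indicator (suc k)) b
subsetSum-ascending u b       zero    _ = ≤-trans (≤-reflexive (subsetSum-indicator-0 u b)) z≤n
subsetSum-ascending u zero    (suc k) p =
  subst₂ _≤_ (sym (subsetSum-indicator-C u k)) (sym (subsetSum-indicator-C u (suc k)))
    (C-ascending u k (s≤s⁻¹ (subst₂ _≤_ (double-suc k) (cong suc (+-identityʳ u)) p)))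
subsetSum-ascending u (suc b) (suc k) p =
  subst₂ _≤_ (sym (subsetSum-indicator-suc u k b)) (sym (subsetSum-indicator-suc u (suc k) b))
    (subsetSum-ascending u b k (s≤s⁻¹ (s≤s⁻¹ (subst₂ _≤_ (double-suc k) (size-suc u b) p))))

subsetSum-descending : ∀ u b k → size (u , b) ≤ k + k →
  subsetSum u (indicator (suc k)) b ≤ subsetSum u (indicator k) b
-- The case `k = 0` cannot occur because sizes are positive.
subsetSum-descending u zero    (suc k) p =
  subst₂ _≤_ (sym (subsetSum-indicator-C u (suc k))) (sym (subsetSum-indicator-C u k))
    (C-descending u k (s≤s⁻¹ (subst₂ _≤_ (cong suc (+-identityʳ u)) (double-suc k) p)))
subsetSum-descending u (suc b) (suc k) p =
  subst₂ _≤_ (sym (subsetSum-indicator-suc u (suc k) b)) (sym (subsetSum-indicator-suc u k b))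
    (subsetSum-descending u b k (s≤s⁻¹ (s≤s⁻¹ (subst₂ _≤_ (size-suc u b) (double-suc k) p))))

-- Unimodality of the Boolean-Narayana numbers.

countedIndicator : ℕ → ℕ → ℕ → ℕ → ℕ
countedIndicator n k m r = if (m ≡ᵇ n) ∧ (suc r ≡ᵇ k) then 1 else 0

-- `countedIndicator` is what the Boolean part of `counted?` computes to, so the two sums compose
-- directly.
BoNa-classes : ∀ n k → BoNa n k ≡ ∑ (λ c → classSum c (countedIndicator n k (size c))) (classes n)
BoNa-classes n k =
  trans (length-filter (counted? n k) (boundedTrees n)) (∑-boundedTrees n (countedIndicator n k))

≡ᵇ-true : ∀ m n → (m ≡ᵇ n) ≡ true → m ≡ n
≡ᵇ-true m n eq = ≡ᵇ⇒≡ m n (subst T (sym eq) _)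

BoNa-ascending : ∀ n k → k + k ≤ n → BoNa n k ≤ BoNa n (suc k)
BoNa-ascending n k 2k≤n =
  subst₂ _≤_ (sym (BoNa-classes n k)) (sym (BoNa-classes n (suc k))) (∑-mono step (classes n))
  where
  step : ∀ c → classSum c (countedIndicator n k (size c)) ≤ classSum c (countedIndicator n (suc k) (size c))
  step (u , b) with size (u , b) ≡ᵇ n in eq
  -- A class of another size contributes zero to both sides.
  ... | false = ≤-refl
  ... | true  = subsetSum-ascending u b k (≤-trans 2k≤n (≤-reflexive (sym (≡ᵇ-true _ n eq))))

BoNa-descending : ∀ n k → n ≤ k + k → BoNa n (suc k) ≤ BoNa n k
BoNa-descending n k n≤2k =
  subst₂ _≤_ (sym (BoNa-classes n (suc k))) (sym (BoNa-classes n k)) (∑-mono step (classes n))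
  where
  step : ∀ c → classSum c (countedIndicator n (suc k) (size c)) ≤ classSum c (countedIndicator n k (size c))
  step (u , b) with size (u , b) ≡ᵇ n in eq
  ... | false = ≤-refl
  ... | true  = subsetSum-descending u b k (≤-trans (≤-reflexive (≡ᵇ-true _ n eq)) n≤2k)

<⌈n/2⌉⇒double≤ : ∀ n k → k < ⌈ n /2⌉ → k + k ≤ n
<⌈n/2⌉⇒double≤ (suc n)       zero    _       = z≤n
<⌈n/2⌉⇒double≤ (suc (suc n)) (suc k) (s≤s p) =
  subst (_≤ suc (suc n)) (sym (double-suc k)) (s≤s (s≤s (<⌈n/2⌉⇒double≤ n k p)))

⌈n/2⌉≤⇒≤double : ∀ n k → ⌈ n /2⌉ ≤ k → n ≤ k + k
⌈n/2⌉≤⇒≤double n k p = begin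
  n                   ≡⟨ ⌊n/2⌋+⌈n/2⌉≡n n ⟨
  ⌊ n /2⌋ + ⌈ n /2⌉   ≤⟨ +-mono-≤ (≤-trans (⌊n/2⌋≤⌈n/2⌉ n) p) p ⟩
  k + k               ∎
  where open ≤-Reasoning

theorem4p1 : (n : ℕ) → 1 ≤ n → Unimodal n (BoNa n)
theorem4p1 n 1≤n =
  -- The peak is the least `k` with `n ≤ k + k`, where the descending case first applies.
  ⌈ n /2⌉ , ⌈n/2⌉-mono 1≤n , ⌈n/2⌉≤n n
  , (λ k _ k<peak → BoNa-ascending n k (<⌈n/2⌉⇒double≤ n k k<peak))
  , (λ k peak≤k _ → BoNa-descending n k (⌈n/2⌉≤⇒≤double n k peak≤k))
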